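{- For every integer $d\ge 1$ there is a refutation of $d\text{ - }\mathrm{RVIP}_n$ in $\mathrm{Res}^*(d+1)$ of size $O(n^{d+4})$ (as a function of $n$, for $n\ge 2$).
   Context: Notation: $[n]=\{1,\dots,n\}$. A literal is a propositional variable or its negation. An $e$-conjunction is a conjunction of at most $e$ literals; an $e$-DNF is a disjunction of arbitrarily many $e$-conjunctions. A clause is a disjunction of literals (so it is an $e$-DNF for every $e\ge 1$). The system $\mathrm{Res}(e)$ ($e\ge1$). Lines are $e$-DNFs. Rules ($\mathcal P,\mathcal Q$ are $e$-DNFs, the $\ell_i$ are literals, and all conjunctions have at most $e$ literals): ($\wedge$-introduction) from $\mathcal P\vee\bigwedge_{i\in I_1}\ell_i$ and $\mathcal Q\vee\bigwedge_{i\in I_2}\ell_i$ derive $\mathcal P\vee\mathcal Q\vee\bigwedge_{i\in I_1\cup I_2}\ell_i$, provided $|I_1\cup I_2|\le e$; (cut) from $\mathcal P\vee\bigvee_{i\in I}\ell_i$ and $\mathcal Q\vee\bigwedge_{i\in I}\neg\ell_i$ derive $\mathcal P\vee\mathcal Q$; (weakening 1) from $\mathcal P$ derive $\mathcal P\vee\bigwedge_{i\in I}\ell_i$, provided $|I|\le e$; (weakening 2) from $\mathcal P\vee\bigwedge_{i\in I_1\cup I_2}\ell_i$ derive $\mathcal P\vee\bigwedge_{i\in I_1}\ell_i$. A refutation of a set of clauses is a derivation of the empty clause from these clauses (axioms). $\mathrm{Res}^*(e)$ is the tree-like version: the underlying graph is required to be a tree (each derived line is used at most once as a premise; axioms may be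 repeated at different leaves). The size of a refutation is the number of internal nodes, i.e. the number of rule applications. The contradiction $d\text{ - }\mathrm{RVIP}_n$ ($d$-relativized vectorized Induction principle). Variables: $R^r_i$ for $i\in[n]$, $r\in[d]$; $P_{i,j}$ for $i,j\in[n]$; and $S_{i,j,l,m}$ for $i\in[n-1]$, $j,l,m\in[n]$. The clauses are: $R^1_1,\dots,R^d_1$, $P_{1,1}$, $R^1_n,\dots,R^d_n$, and $\neg P_{n,j}$ for $j\in[n]$; $\bigvee_{l>i,\ m\in[n]}S_{i,j,l,m}$ (with $l\in[n]$) for $i\in[n-1]$, $j\in[n]$; $\neg S_{i,j,l,m}\vee\neg R^1_i\vee\dots\vee\neg R^d_i\vee\neg P_{i,j}\vee R^r_l$ for $i\in[n-1]$, $j,l,m\in[n]$, $r\in[d]$; $\neg S_{i,j,l,m}\vee\neg R^1_i\vee\dots\vee\neg R^d_i\vee\neg P_{i,j}\vee P_{l,m}$ for $i\in[n-1]$, $j,l,m\in[n]$. -}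

module Defs where

open import Data.Fin using (Fin; zero; inject₁; fromℕ)
open import Data.Fin.Properties using (_<?_)
open import Data.List using (List; []; _∷_; [_]; _++_; map; filter; length; allFin; concatMap)
open import Data.List.Properties using (length-map)
open import Data.List.Relation.Binary.BagAndSetEquality using (_∼[_]_; set; [_]-Equality)
open import Data.List.Relation.Binary.Subset.Propositional using (_⊆_)
import Data.List.Relation.Binary.Subset.Setoid as SetoidSubset
open import Data.Nat using (ℕ; suc; pred; _+_; _≤_; NonZero; >-nonZero⁻¹)
open import Data.Nat.Properties using (≤-trans; ≤-reflexive)
open import Data.Product using (_×_)
open import Level using (0ℓ)
open import Relation.Binary.Bundles using (Setoid)
import Relation.Binary.Construct.On as On
open import Relation.Unary using (Pred)

data Literal (V : Set) : Set where
  pos neg : V → Literal V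

complement : {V : Set} → Literal V → Literal V
complement (pos v) = neg v
complement (neg v) = pos v

Clause : Set → Set
Clause V = List (Literal V)

-- The list stands for its set of elements, so a set of literals of
-- cardinality at most e is one having some listing of length at most e.
record Conjunction (V : Set) (e : ℕ) : Set where
  constructor conj
  field
    literals : List (Literal V)
    .bounded : length literals ≤ e

open Conjunction public

DNF : Set → ℕ → Set
DNF V e = List (Conjunction V e)

conjunctionSetoid : Set → ℕ → Setoid 0ℓ 0ℓ
conjunctionSetoid V e = On.setoid ([ set ]-Equality (Literal V)) (literals {V} {e})

infix 4 _≋_

-- Equality of DNFs as sets of sets of literals.
_≋_ : {V : Set} {e : ℕ} → DNF V e → DNF V e → Set
_≋_ {V} {e} D D′ = (D ⊑ D′) × (D′ ⊑ D)
  where open SetoidSubset (conjunctionSetoid V e) renaming (_⊆_ to _⊑_)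

unit : {V : Set} {e : ℕ} .{{_ : NonZero e}} → Literal V → Conjunction V e
unit {e = e} ℓ = conj [ ℓ ] (>-nonZero⁻¹ e)

fromClause : {V : Set} {e : ℕ} .{{_ : NonZero e}} → Clause V → DNF V e
fromClause = map unit

complementAll : {V : Set} {e : ℕ} → Conjunction V e → Conjunction V e
complementAll (conj ls b) =
  conj (map complement ls) (≤-trans (≤-reflexive (length-map complement ls)) b)

-- Tree-like Res(e) derivations from the axioms Ax. Every constructor
-- concludes an arbitrary D set-equal to the literal conclusion of its rule,
-- so lines are identified up to _≋_ without any cost in size.
data Derivation {V : Set} {e : ℕ} .{{_ : NonZero e}} (Ax : Pred (Clause V) 0ℓ) :
                DNF V e → Set where

  axiom : ∀ {D} (c : Clause V) → Ax c →
          fromClause c ≋ D → Derivation Ax D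

  ∧-introduction : ∀ {D} (𝓟 𝓠 : DNF V e) (C₁ C₂ C : Conjunction V e) →
                   literals C ∼[ set ] (literals C₁ ++ literals C₂) →
                   Derivation Ax (𝓟 ++ [ C₁ ]) →
                   Derivation Ax (𝓠 ++ [ C₂ ]) →
                   𝓟 ++ 𝓠 ++ [ C ] ≋ D → Derivation Ax D

  cut : ∀ {D} (𝓟 𝓠 : DNF V e) (C : Conjunction V e) →
        Derivation Ax (𝓟 ++ fromClause (literals C)) →
        Derivation Ax (𝓠 ++ [ complementAll C ]) →
        𝓟 ++ 𝓠 ≋ D → Derivation Ax D

  weakening₁ : ∀ {D} (𝓟 : DNF V e) (C : Conjunction V e) →
               Derivation Ax 𝓟 →
               𝓟 ++ [ C ] ≋ D → Derivation Ax D

  weakening₂ : ∀ {D} (𝓟 : DNF V e) (C C₁ : Conjunction V e) →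
               literals C₁ ⊆ literals C →
               Derivation Ax (𝓟 ++ [ C ]) →
               𝓟 ++ [ C₁ ] ≋ D → Derivation Ax D

-- Axiom leaves are not counted.
size : {V : Set} {e : ℕ} .{{_ : NonZero e}} {Ax : Pred (Clause V) 0ℓ} {D : DNF V e} →
       Derivation Ax D → ℕ
size (axiom _ _ _)                    = 0
size (∧-introduction _ _ _ _ _ _ π ρ _) = suc (size π + size ρ)
size (cut _ _ _ π ρ _)                = suc (size π + size ρ)
size (weakening₁ _ _ π _)             = suc (size π)
size (weakening₂ _ _ _ _ π _)         = suc (size π)

Refutation : {V : Set} (e : ℕ) .{{_ : NonZero e}} → Pred (Clause V) 0ℓ → Set
Refutation e Ax = Derivation {e = e} Ax []

-- [n] is Fin n, numbered from zero; [n-1] is Fin (pred n), which sits inside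
-- [n] through inject₁.
data Var (d n : ℕ) : Set where
  R : (r : Fin d) (i : Fin n) → Var d n
  P : (i j : Fin n) → Var d n
  S : (i : Fin (pred n)) (j l m : Fin n) → Var d n

someSuccessor : ∀ {d k} (i : Fin k) (j : Fin (suc k)) → Clause (Var d (suc k))
someSuccessor {k = k} i j =
  concatMap (λ l → map (λ m → pos (S i j l m)) (allFin (suc k)))
            (filter (inject₁ i <?_) (allFin (suc k)))

-- ¬S_{i,j,l,m} ∨ ¬R^1_i ∨ … ∨ ¬R^d_i ∨ ¬P_{i,j}
guard : ∀ {d k} (i : Fin k) (j l m : Fin (suc k)) → Clause (Var d (suc k))
guard {d} i j l m =
  neg (S i j l m) ∷ map (λ r → neg (R r (inject₁ i))) (allFin d) ++ [ neg (P (inject₁ i) j) ]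

data RVIP (d : ℕ) : (n : ℕ) → Pred (Clause (Var d n)) 0ℓ where
  R-first   : ∀ {k} (r : Fin d) → RVIP d (suc k) [ pos (R r zero) ]
  P-first   : ∀ {k} → RVIP d (suc k) [ pos (P zero zero) ]
  R-last    : ∀ {k} (r : Fin d) → RVIP d (suc k) [ pos (R r (fromℕ k)) ]
  ¬P-last   : ∀ {k} (j : Fin (suc k)) → RVIP d (suc k) [ neg (P (fromℕ k) j) ]
  successor : ∀ {k} (i : Fin k) (j : Fin (suc k)) → RVIP d (suc k) (someSuccessor i j)
  R-step    : ∀ {k} (i : Fin k) (j l m : Fin (suc k)) (r : Fin d) →
              RVIP d (suc k) (guard i j l m ++ [ pos (R r l) ])
  P-step    : ∀ {k} (i : Fin k) (j l m : Fin (suc k)) →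
              RVIP d (suc k) (guard i j l m ++ [ pos (P l m) ])

{-# OPTIONS --safe #-}

-- Write C(l,m) for R^1_l ∧ … ∧ R^d_l ∧ P_{l,m} and L(t) for the disjunction of
-- all C(l,m) with l ≥ t. The axioms give C(1,1), hence L(1) by weakening. Each
-- ¬C(l,j) ∨ L(l+1) has a derivation with O(n²) rules: cut every S_{l,j,l',m} of
-- the successor axiom against ¬S_{l,j,l',m} ∨ ¬C(l,j) ∨ C(l',m). Cutting L(t)
-- against these for l = t and all j leaves L(t+1), and L(n+1) is empty. The main
-- branch is used linearly, so the tree has only O(n⁴) nodes.
module Submission where

open import Defs
open import Data.Fin using (Fin; zero; toℕ; fromℕ<; inject₁)
open import Data.Fin.Properties using (toℕ-fromℕ<; toℕ-injective; toℕ<n)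
open import Data.Fin.Relation.Unary.Top using (view; ‵fromℕ; ‵inject₁)
open import Data.List 
  using (List; []; _∷_; [_]; _++_; map; filter; length; allFin; concatMap; cartesianProduct)
open import Data.List.Membership.Propositional using (_∈_)
open import Data.List.Membership.Propositional.Properties
  using (∈-++⁻; ∈-++⁺ˡ; ∈-++⁺ʳ; ∈-map⁺; ∈-map⁻; ∈-allFin; ∈-filter⁺; ∈-filter⁻;
         ∈-cartesianProduct⁺; ∈-cartesianProduct⁻)
open import Data.List.Properties
  using (length-map; length-tabulate; length-++; length-filter; map-++; map-∘)
open import Data.List.Relation.Binary.BagAndSetEquality using ([_]-Equality; set)
open import Data.List.Relation.Binary.Permutation.Propositional using (_↭_; ↭-sym)
open import Data.List.Relation.Binary.Permutation.Propositional.Properties using (∷↭∷ʳ; ++-comm)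
open import Data.List.Relation.Binary.Subset.Propositional using (_⊆_)
open import Data.List.Relation.Binary.Subset.Propositional.Properties
  using (⊆-refl; ⊆-trans; ⊆-reflexive; ⊆-reflexive-↭; Any-resp-⊆; ++⁺ˡ; ++⁺ʳ; xs⊆ys++xs; xs⊆xs++ys)
  renaming (map⁺ to ⊆-map⁺)
open import Data.List.Relation.Unary.All using (All; []; _∷_)
open import Data.List.Relation.Unary.All.Properties using (map⁺; tabulate⁺)
open import Data.List.Relation.Unary.Any using (here; there)
open import Data.Nat
  using (ℕ; zero; suc; _+_; _*_; _^_; _≤_; _≤?_; z≤n; s≤s; NonZero)
open import Data.Nat.Properties
open import Data.Nat.Solver using (module +-*-Solver)
open import Data.Product using (Σ-syntax; ∃-syntax; _×_; _,_; proj₁; proj₂)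
open import Data.Sum using ([_,_]′; inj₁; inj₂)
open import Function using (_∘_; id)
open import Level using (0ℓ)
open import Relation.Binary.Bundles using (Setoid)
open import Relation.Binary.PropositionalEquality
  using (_≡_; refl; sym; trans; cong; cong₂; subst)
open import Relation.Nullary using (contradiction)
open import Relation.Unary using (Pred)

-- Lists: inclusion and Cartesian products.

++-least : {A : Set} {xs ys zs : List A} → xs ⊆ zs → ys ⊆ zs → xs ++ ys ⊆ zs
++-least {xs = xs} xs⊆zs ys⊆zs = [ xs⊆zs , ys⊆zs ]′ ∘ ∈-++⁻ xs

length-cartesianProduct : {A B : Set} (xs : List A) (ys : List B) →
                          length (cartesianProduct xs ys) ≡ length xs * length ys
length-cartesianProduct []       ys = refl
length-cartesianProduct (x ∷ xs) ys =
  trans (length-++ (map (x ,_) ys))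
        (cong₂ _+_ (length-map (x ,_) ys) (length-cartesianProduct xs ys))

map-cartesianProduct : {A B C : Set} (f : A × B → C) (xs : List A) (ys : List B) →
                       map f (cartesianProduct xs ys) ≡
                       concatMap (λ x → map (λ y → f (x , y)) ys) xs
map-cartesianProduct f []       ys = refl
map-cartesianProduct f (x ∷ xs) ys =
  trans (map-++ f (map (x ,_) ys) _)
        (cong₂ _++_ (sym (map-∘ ys)) (map-cartesianProduct f xs ys))

-- Derivations with size bounds in tree-like Res(e).

Derivation≤ : {V : Set} {e : ℕ} .{{_ : NonZero e}} →
              Pred (Clause V) 0ℓ → ℕ → DNF V e → Set
Derivation≤ Ax s D = Σ[ π ∈ Derivation Ax D ] size π ≤ s

module _ {V : Set} {e : ℕ} where

  ⊆⇒≋ : {D D′ : DNF V e} → D ⊆ D′ → D′ ⊆ D → D ≋ D′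
  ⊆⇒≋ D⊆D′ D′⊆D = Any-resp-⊆ D⊆D′ , Any-resp-⊆ D′⊆D

  ↭⇒≋ : {D D′ : DNF V e} → D ↭ D′ → D ≋ D′
  ↭⇒≋ p = ⊆⇒≋ (⊆-reflexive-↭ p) (⊆-reflexive-↭ (↭-sym p))

  ≡⇒≋ : {D D′ : DNF V e} → D ≡ D′ → D ≋ D′
  ≡⇒≋ refl = ⊆⇒≋ id id

  ≋-trans : {D D′ D″ : DNF V e} → D ≋ D′ → D′ ≋ D″ → D ≋ D″
  ≋-trans (f , f′) (g , g′) = (λ {x} x∈ → g {x} (f {x} x∈)) , (λ {x} x∈ → f′ {x} (g′ {x} x∈))

module _ {V : Set} {e : ℕ} .{{_ : NonZero e}} {Ax : Pred (Clause V) 0ℓ} where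

  -- Each rule already concludes up to `_≋_`, so the equality is composed into the last rule and
  -- costs nothing.
  convert : {D D′ : DNF V e} {s : ℕ} → D ≋ D′ → Derivation≤ Ax s D → Derivation≤ Ax s D′
  convert eq (axiom c a p , b) = axiom c a (≋-trans p eq) , b
  convert eq (∧-introduction 𝓟 𝓠 C₁ C₂ C u π ρ p , b) =
    ∧-introduction 𝓟 𝓠 C₁ C₂ C u π ρ (≋-trans p eq) , b
  convert eq (cut 𝓟 𝓠 C π ρ p , b) = cut 𝓟 𝓠 C π ρ (≋-trans p eq) , b
  convert eq (weakening₁ 𝓟 C π p , b) = weakening₁ 𝓟 C π (≋-trans p eq) , b
  convert eq (weakening₂ 𝓟 C C₁ u π p , b) = weakening₂ 𝓟 C C₁ u π (≋-trans p eq) , b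

  relax : {D : DNF V e} {s t : ℕ} → s ≤ t → Derivation≤ Ax s D → Derivation≤ Ax t D
  relax s≤t (π , b) = π , ≤-trans b s≤t

  weaken : (Δ : DNF V e) {D : DNF V e} {s : ℕ} →
           Derivation≤ Ax s D → Derivation≤ Ax (length Δ + s) (Δ ++ D)
  weaken []      π = π
  weaken (C ∷ Δ) π with weaken Δ π
  ... | ρ , b = weakening₁ (Δ ++ _) C ρ (↭⇒≋ (↭-sym (∷↭∷ʳ C (Δ ++ _)))) , s≤s b

  -- The literals are joined one at a time, one introduction for each after the first. Both premises
  -- carry the same Γ, and set equality merges the two copies.
  conjoin : (Γ : DNF V e) (ℓ : Literal V) (ls : List (Literal V)) .(b : length (ℓ ∷ ls) ≤ e) →
            All (λ ℓ′ → Derivation≤ Ax 0 (Γ ++ [ unit ℓ′ ])) (ℓ ∷ ls) →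
            Derivation≤ Ax (length ls) (Γ ++ [ conj (ℓ ∷ ls) b ])
  conjoin Γ ℓ []        b (π ∷ []) = π
  conjoin Γ ℓ (ℓ′ ∷ ls) b ((π , π≤0) ∷ πs)
    with conjoin Γ ℓ′ ls (≤-trans (n≤1+n _) b) πs
  ... | ρ , ρ≤ =
    ∧-introduction Γ Γ (unit ℓ) (conj (ℓ′ ∷ ls) (≤-trans (n≤1+n _) b)) (conj (ℓ ∷ ℓ′ ∷ ls) b)
      (Setoid.refl ([ set ]-Equality (Literal V))) π ρ
      (⊆⇒≋ (++-least (xs⊆xs++ys Γ _) ⊆-refl) (xs⊆ys++xs _ Γ)) ,
    s≤s (+-mono-≤ π≤0 ρ≤)

  -- The running line is the right premise of every cut and is used once, so sizes add up: each x
  -- costs its side derivation plus one cut. The side formulas `𝓟 x` lie in Γ and are absorbed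
  -- there. The parameter m is the size of the running derivation.
  cutAll : {A : Set} (B : A → Conjunction V e) (𝓟 : A → DNF V e) (Γ : DNF V e) {s : ℕ} →
           (∀ x → Derivation≤ Ax s (𝓟 x ++ fromClause (literals (B x)))) →
           (xs : List A) {m : ℕ} → (∀ {x} → x ∈ xs → 𝓟 x ⊆ Γ) →
           Derivation≤ Ax m (map (complementAll ∘ B) xs ++ Γ) →
           Derivation≤ Ax (length xs * suc s + m) Γ
  cutAll B 𝓟 Γ side []       𝓟⊆Γ π = π
  cutAll B 𝓟 Γ {s} side (x ∷ xs) {m} 𝓟⊆Γ π
    with side x | convert (↭⇒≋ (∷↭∷ʳ _ (map (complementAll ∘ B) xs ++ Γ))) π
  ... | ρ , ρ≤ | π′ , π≤ =
    relax (≤-reflexive rearrange)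
      (cutAll B 𝓟 Γ side xs (𝓟⊆Γ ∘ there)
        ( cut (𝓟 x) (map (complementAll ∘ B) xs ++ Γ) (B x) ρ π′
            (⊆⇒≋ (++-least (⊆-trans (𝓟⊆Γ (here refl)) (xs⊆ys++xs Γ _)) ⊆-refl)
                 (xs⊆ys++xs _ (𝓟 x)))
        , s≤s (+-mono-≤ ρ≤ π≤)))
    where
    open +-*-Solver
    rearrange : length xs * suc s + suc (s + m) ≡ suc (s + length xs * suc s) + m
    rearrange = solve 3 (λ a b c → a :+ (con 1 :+ (b :+ c)) := con 1 :+ (b :+ a) :+ c) refl
                  (length xs * suc s) s m

-- Index pairs (l,m) with l at least t.

from : (n t : ℕ) → List (Fin n × Fin n)
from n t = cartesianProduct (filter (λ l → t ≤? toℕ l) (allFin n)) (allFin n)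

∈-from⁺ : ∀ {n t} {l m : Fin n} → t ≤ toℕ l → (l , m) ∈ from n t
∈-from⁺ t≤l = ∈-cartesianProduct⁺ (∈-filter⁺ _ (∈-allFin _) t≤l) (∈-allFin _)

∈-from⁻ : ∀ {n t} {l m : Fin n} → (l , m) ∈ from n t → t ≤ toℕ l
∈-from⁻ {n} p = proj₂ (∈-filter⁻ _ {xs = allFin n} (proj₁ (∈-cartesianProduct⁻ _ (allFin n) p)))

length-allFin : ∀ n → length (allFin n) ≡ n
length-allFin n = length-tabulate {n = n} id

length-from : ∀ n t → length (from n t) ≤ n * n
length-from n t = begin
  length (from n t)                                 ≡⟨ length-cartesianProduct late (allFin n) ⟩
  length late * length (allFin n)                   ≤⟨ *-monoˡ-≤ _ (length-filter _ (allFin n)) ⟩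
  length (allFin n) * length (allFin n)             ≡⟨ cong₂ _*_ (length-allFin n) (length-allFin n) ⟩
  n * n                                             ∎
  where
  open ≤-Reasoning
  late = filter (λ l → t ≤? toℕ l) (allFin n)

-- The lines of the refutation.

module _ (d k : ℕ) where

  private
    n : ℕ
    n = suc k

    V : Set
    V = Var d n

  -- The literals of the clause ¬C(l,m), packed as a conjunction because `cut` takes one: it reads
  -- the literals as a clause in the left premise and, through `complementAll`, as C(l,m) in the
  -- right premise. Having d+1 literals, it fits in Res(d+1).
  ¬present : Fin n × Fin n → Conjunction V (suc d)
  ¬present (l , m) =
    conj (neg (P l m) ∷ map (λ r → neg (R r l)) (allFin d))
         (s≤s (≤-reflexive (trans (length-map _ (allFin d)) (length-allFin d))))

  present : Fin n × Fin n → Conjunction V (suc d)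
  present = complementAll ∘ ¬present

  ¬presentDNF : Fin n × Fin n → DNF V (suc d)
  ¬presentDNF p = fromClause (literals (¬present p))

  length-¬presentDNF : ∀ p → length (¬presentDNF p) ≡ suc d
  length-¬presentDNF p = trans (length-map unit (literals (¬present p)))
    (cong suc (trans (length-map _ (allFin d)) (length-allFin d)))

  -- Indices start at zero here: L(1) is `presentFrom 0`, and the empty L(n+1) is `presentFrom n`.
  presentFrom : ℕ → DNF V (suc d)
  presentFrom t = map present (from n t)

  introducePresent : (Γ : DNF V (suc d)) (l m : Fin n) →
                     (∀ r → Derivation≤ (RVIP d n) 0 (Γ ++ [ unit (pos (R r l)) ])) →
                     Derivation≤ (RVIP d n) 0 (Γ ++ [ unit (pos (P l m)) ]) →
                     Derivation≤ (RVIP d n) d (Γ ++ [ present (l , m) ])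
  introducePresent Γ l m πR πP =
    relax (≤-reflexive (trans (length-map complement (map (λ r → neg (R r l)) (allFin d)))
              (trans (length-map _ (allFin d)) (length-allFin d))))
      (conjoin Γ _ _ _ (πP ∷ map⁺ (map⁺ (tabulate⁺ πR))))

  -- Deriving ¬C(l,j) ∨ L(l+1).

  module _ (i : Fin k) (j : Fin n) where

    private
      p : Fin n × Fin n
      p = inject₁ i , j

    stepAxiom : (l m : Fin n) (v : V) → RVIP d n (guard i j l m ++ [ pos v ]) →
                Derivation≤ (RVIP d n) 0
                  ((unit (neg (S i j l m)) ∷ ¬presentDNF p) ++ [ unit (pos v) ])
    stepAxiom l m v a = axiom (guard i j l m ++ [ pos v ]) a
      (⊆⇒≋ (⊆-trans (⊆-reflexive (map-++ unit (guard i j l m) [ pos v ]))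
                    (++⁺ˡ _ (⊆-map⁺ unit (⊆-reflexive-↭ guard↭))))
           (⊆-trans (++⁺ˡ _ (⊆-map⁺ unit (⊆-reflexive-↭ (↭-sym guard↭))))
                    (⊆-reflexive (sym (map-++ unit (guard i j l m) [ pos v ]))))) , z≤n
      where
      -- `guard` lists the P-literal last, `¬present` lists it first.
      guard↭ : guard i j l m ↭ neg (S i j l m) ∷ literals (¬present p)
      guard↭ = _↭_.prep _ (↭-sym (∷↭∷ʳ _ _))

    -- The d+1 step axioms for fixed i, j, l, m share their guard, so d introductions merge their
    -- last literals into C(l,m).
    deriveStep : (q : Fin n × Fin n) →
                 Derivation≤ (RVIP d n) d
                   ((¬presentDNF p ++ [ present q ]) ++ [ unit (neg (S i j (proj₁ q) (proj₂ q))) ])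
    deriveStep q@(l , m) = convert (↭⇒≋ (∷↭∷ʳ _ (¬presentDNF p ++ [ present q ])))
      (introducePresent (unit (neg (S i j l m)) ∷ ¬presentDNF p) l m
        (λ r → stepAxiom l m (R r l) (R-step i j l m r))
        (stepAxiom l m (P l m) (P-step i j l m)))

    -- In this form the filter in `from` agrees definitionally with the test `inject₁ i <?_` of the
    -- successor axiom.
    later : ℕ
    later = suc (toℕ (inject₁ i))

    deriveLater : Derivation≤ (RVIP d n)
                    (length (from n later) * suc d +
                      (length (¬presentDNF p ++ presentFrom later) + 0))
                    (¬presentDNF p ++ presentFrom later)
    -- Each cut is on the single literal ¬S, whose complement is a disjunct of the successor axiom;
    -- that axiom starts the running line.
    deriveLater = cutAll (λ (l , m) → conj [ neg (S i j l m) ] (s≤s z≤n))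
      (λ q → ¬presentDNF p ++ [ present q ]) (¬presentDNF p ++ presentFrom later)
      deriveStep (from n later)
      (λ q∈ → ++⁺ʳ (¬presentDNF p) λ { (here refl) → ∈-map⁺ present q∈ })
      -- `cutAll` keeps its target fixed, so the axiom is first weakened by the whole target, one
      -- rule per conjunction.
      (convert (↭⇒≋ (++-comm (¬presentDNF p ++ presentFrom later) _))
        (weaken (¬presentDNF p ++ presentFrom later) successorAxiom))
      where
      successorAxiom : Derivation≤ (RVIP d n) 0
        (map (λ (l , m) → unit (pos (S i j l m))) (from n later))
      successorAxiom = axiom _ (successor i j)
        (≡⇒≋ (trans (cong fromClause (sym (map-cartesianProduct (λ (l , m) → pos (S i j l m))
                                                (filter (λ l → later ≤? toℕ l) (allFin n)) (allFin n))))
                    (sym (map-∘ (from n later))))) , z≤n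

  -- At most n² cuts, each with a side derivation of size d, then weakenings by d+1 literals and at
  -- most n² conjunctions.
  exitCost : ℕ
  exitCost = n * n * suc d + (suc d + n * n)

  deriveExit : (l j : Fin n) →
               Derivation≤ (RVIP d n) exitCost
                 (presentFrom (suc (toℕ l)) ++ ¬presentDNF (l , j))
  deriveExit l j with view l
  ... | ‵inject₁ i = convert (↭⇒≋ (++-comm (¬presentDNF (inject₁ i , j)) _))
        (relax bound (deriveLater i j))
    where
    open ≤-Reasoning
    q = inject₁ i , j
    t = later i j
    bound : length (from n t) * suc d + (length (¬presentDNF q ++ presentFrom t) + 0) ≤ exitCost
    bound = +-mono-≤ (*-monoˡ-≤ (suc d) (length-from n t)) (begin
      length (¬presentDNF q ++ presentFrom t) + 0         ≡⟨ +-identityʳ _ ⟩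
      length (¬presentDNF q ++ presentFrom t)             ≡⟨ length-++ (¬presentDNF q) ⟩
      length (¬presentDNF q) + length (presentFrom t)     ≡⟨ cong₂ _+_ (length-¬presentDNF q) (length-map present (from n t)) ⟩
      suc d + length (from n t)                           ≤⟨ +-monoʳ-≤ (suc d) (length-from n t) ⟩
      suc d + n * n                                       ∎)
  ... | ‵fromℕ = relax bound (weaken (presentFrom t) (convert absorb
        (weaken (¬presentDNF q) (axiom [ neg (P l j) ] (¬P-last j) (≡⇒≋ refl) , z≤n))))
    where
    open ≤-Reasoning
    q = l , j
    t = suc (toℕ l)
    absorb : ¬presentDNF q ++ [ unit (neg (P l j)) ] ≋ ¬presentDNF q
    absorb = ⊆⇒≋ (++-least ⊆-refl λ { (here refl) → here refl }) (xs⊆xs++ys _ _)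
    bound : length (presentFrom t) + (length (¬presentDNF q) + 0) ≤ exitCost
    bound = begin
      length (presentFrom t) + (length (¬presentDNF q) + 0)   ≡⟨ cong₂ _+_ (length-map present (from n t))
                                                                    (trans (+-identityʳ _) (length-¬presentDNF q)) ⟩
      length (from n t) + suc d                               ≤⟨ +-monoˡ-≤ (suc d) (length-from n t) ⟩
      n * n + suc d                                           ≡⟨ +-comm (n * n) (suc d) ⟩
      suc d + n * n                                           ≤⟨ m≤n+m _ (n * n * suc d) ⟩
      exitCost                                                ∎

  -- Advancing from L(1) to the empty line.

  presentFrom-toℕ : (l : Fin n) →
    presentFrom (toℕ l) ≋ map (λ j → present (l , j)) (allFin n) ++ presentFrom (suc (toℕ l))
  presentFrom-toℕ l = ⊆⇒≋ split (++-least row rest)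
    where
    split : presentFrom (toℕ l) ⊆ map (λ j → present (l , j)) (allFin n) ++ presentFrom (suc (toℕ l))
    split x∈ with ∈-map⁻ present x∈
    ... | (l′ , m) , lm∈ , refl with m≤n⇒m<n∨m≡n (∈-from⁻ {n} {toℕ l} lm∈)
    ...   | inj₁ l<l′ = ∈-++⁺ʳ _ (∈-map⁺ present (∈-from⁺ {n} {suc (toℕ l)} l<l′))
    ...   | inj₂ l≡l′ with toℕ-injective l≡l′
    ...     | refl = ∈-++⁺ˡ (∈-map⁺ (λ j → present (l , j)) (∈-allFin m))

    row : map (λ j → present (l , j)) (allFin n) ⊆ presentFrom (toℕ l)
    row x∈ with ∈-map⁻ (λ j → present (l , j)) x∈
    ... | j , _ , refl = ∈-map⁺ present (∈-from⁺ {n} {toℕ l} ≤-refl)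

    rest : presentFrom (suc (toℕ l)) ⊆ presentFrom (toℕ l)
    rest = ⊆-map⁺ present λ lm∈ → ∈-from⁺ {n} {toℕ l} (<⇒≤ (∈-from⁻ {n} {suc (toℕ l)} lm∈))

  presentFrom-n : presentFrom n ≡ []
  presentFrom-n with from n n in eq
  ... | []          = refl
  ... | (l , m) ∷ _ =
    contradiction (∈-from⁻ {n} {n} (subst ((l , m) ∈_) (sym eq) (here refl))) (<⇒≱ (toℕ<n l))

  -- The previous line enters only once, at the start of n cuts, so each index adds n(`exitCost` +
  -- 1) instead of multiplying the size. The base case spends d introductions on C(1,1) and at most
  -- n² weakenings.
  derivePresentFrom : ∀ t → t ≤ n →
    Derivation≤ (RVIP d n) (t * (n * suc exitCost) + (n * n + d)) (presentFrom t)
  derivePresentFrom zero _ =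
    relax (+-monoˡ-≤ d (≤-trans (≤-reflexive (length-map present (from n 0))) (length-from n 0)))
      (convert absorb (weaken (presentFrom 0)
        (introducePresent [] zero zero
          (λ r → axiom _ (R-first r) (≡⇒≋ refl) , z≤n)
          (axiom _ P-first (≡⇒≋ refl) , z≤n))))
    where
    absorb : presentFrom 0 ++ [ present (zero , zero) ] ≋ presentFrom 0
    absorb = ⊆⇒≋ (++-least ⊆-refl λ { (here refl) → ∈-map⁺ present (∈-from⁺ {n} {0} z≤n) })
                  (xs⊆xs++ys _ _)
  derivePresentFrom (suc t) t<n
    -- Matching on the equation replaces t by `toℕ l`, the form in which the row of l can be split
    -- off.
    with fromℕ< t<n | toℕ-fromℕ< t<n
  ... | l | refl =
    relax (≤-reflexive cost)
      (cutAll (λ j → ¬present (l , j)) (λ _ → presentFrom (suc t)) (presentFrom (suc t))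
        (deriveExit l) (allFin n) (λ _ → ⊆-refl)
        (convert (presentFrom-toℕ l) (derivePresentFrom t (<⇒≤ t<n))))
    where
    cost : length (allFin n) * suc exitCost + (t * (n * suc exitCost) + (n * n + d)) ≡
           suc t * (n * suc exitCost) + (n * n + d)
    cost = trans (cong (λ x → x * suc exitCost + (t * (n * suc exitCost) + (n * n + d))) (length-allFin n))
                 (sym (+-assoc (n * suc exitCost) _ _))

  -- The polynomial size bound.

  totalCost : n * (n * suc exitCost) + (n * n + d) ≤ (3 * d + 5) * n ^ (d + 4)
  totalCost = begin
    n * (n * suc exitCost) + (n * n + d)
      ≡⟨ solve 2 (λ n d → n :* (n :* (con 1 :+ (n :* n :* (con 1 :+ d) :+ ((con 1 :+ d) :+ n :* n)))) :+ (n :* n :+ d)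
             := (con 2 :+ d) :* (n :^ 4) :+ ((con 3 :+ d) :* (n :^ 2) :+ d :* con 1)) refl n d ⟩
    (2 + d) * n ^ 4 + ((3 + d) * n ^ 2 + d * 1)
      -- The powers 4, 2 and 0 of n are all raised to d+4; the coefficients then sum to 3d+5.
      ≤⟨ +-mono-≤ (*-monoʳ-≤ (2 + d) (^-monoʳ-≤ n (m≤n+m 4 d)))
           (+-mono-≤ (*-monoʳ-≤ (3 + d) (^-monoʳ-≤ n (≤-trans (s≤s (s≤s z≤n)) (m≤n+m 4 d))))
                     (*-monoʳ-≤ d (^-monoʳ-≤ n {0} {d + 4} z≤n))) ⟩
    (2 + d) * n ^ (d + 4) + ((3 + d) * n ^ (d + 4) + d * n ^ (d + 4))
      ≡⟨ solve 2 (λ d x → (con 2 :+ d) :* x :+ ((con 3 :+ d) :* x :+ d :* x)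
             := (con 3 :* d :+ con 5) :* x) refl d (n ^ (d + 4)) ⟩
    (3 * d + 5) * n ^ (d + 4) ∎
    where
    open ≤-Reasoning
    open +-*-Solver

proposition7 : ∀ (d : ℕ) → 1 ≤ d → ∃[ c ] (∀ (n : ℕ) → 2 ≤ n → Σ[ π ∈ Refutation (suc d) (RVIP d n) ] size π ≤ c * n ^ (d + 4))
proposition7 d _ = 3 * d + 5 , λ where
  (suc k) _ → relax (totalCost d k)
    (convert (≡⇒≋ (presentFrom-n d k)) (derivePresentFrom d k (suc k) ≤-refl))
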